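{- For each $n$, the Bell equivalence classes of permutations in $\mathfrak S_n$ are intervals of the right weak order on $\mathfrak S_n$. The class of $\sigma\in\mathfrak S_n$ consists of the linear extensions of the poset $P(\sigma)=P(PSA(\sigma))$. The maximal elements of these intervals are exactly the permutations in $\mathfrak S_n$ that avoid the dashed pattern $21-3$.
   Context: Permutations of $\mathfrak S_n$ are written as words $\sigma_1\cdots\sigma_n$. Bell congruence. On words over a totally ordered alphabet, the Bell congruence $\equiv$ is the congruence of the free monoid generated by the relations $buca\equiv buac$ whenever $a<b<c$ are letters and $u$ is a (possibly empty) word all of whose letters are smaller than $b$. Bell equivalence classes of permutations are the equivalence classes of $\equiv$ on $\mathfrak S_n$. Right weak order on $\mathfrak S_n$: the order generated by $\sigma<\tau$ when $\tau$ is obtained from $\sigma$ by exchanging two adjacent letters $\sigma_i<\sigma_{i+1}$. Pattern avoidance. A permutation $\sigma$ avoids $21-3$ if there are no indices $i$ and $j$ with $i+1<j$ and $\sigma_{i+1}<\sigma_i<\sigma_j$. The set partition $PSA(w)$. For a word $w=w_1\cdots w_n$ without repeated letters, start with $S=\emptyset$ and read $w$ from left to right. For each letter $w_i$, consider the blocks of $S$ whose maximal element is smaller than $w_i$; if there is none, add the new block $\{w_i\}$ to $S$; otherwise, insert $w_i$ in the block among these whose maximal element is the greatest. The resulting set partition $S$ is $PSA(w)$. The poset $P(S)$. For a set partition $S$ of $\{1,\ldots,n\}$, order its blocks from left to right so that their maximal elements decrease. $P(S)$ is the partial order $<_P$ on $\{1,\ldots,n\}$ obtained as the transitive (and reflexive)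 closure of the following relations: for each element $x$ of a block $s$, $x>_Px'$ where $x'$ is the greatest element of $s$ smaller than $x$ (if it exists), and $x>_Px''$ where $x''$ is the smallest element greater than $x$ in the block immediately to the left of $s$ (if such a block and such an element exist). A linear extension of $P(S)$ is identified with a permutation $\tau\in\mathfrak S_n$ such that $x<_Py$ implies that $x$ occurs to the left of $y$ in the word $\tau$. -}

module Defs where

open import Data.Bool using (if_then_else_)
open import Data.Fin using (Fin; toℕ)
open import Data.List using (List; []; _∷_; _++_; length; lookup; map; upTo; filter; foldl)
open import Data.List.Extrema.Nat using (argmax; max)
open import Data.List.Membership.Propositional using () renaming (_∈_ to _∈ₗ_)
open import Data.List.Properties using (≡-dec)
open import Data.List.Relation.Binary.Permutation.Propositional using (_↭_)
open import Data.List.Relation.Unary.All using (All)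
open import Data.Nat using (ℕ; suc; _<_; _≤_; _<?_; _≟_)
open import Data.Product using (Σ-syntax; ∃₂; _×_)
open import Level using (0ℓ)
open import Relation.Binary using (Rel)
open import Relation.Binary.Construct.Closure.ReflexiveTransitive using (Star)
open import Relation.Binary.PropositionalEquality using (_≡_; _≢_)
open import Relation.Nullary using (¬_; does)
open import Relation.Unary using (Pred; _∈_; _≐_)

Word : Set
Word = List ℕ

𝔖 : ℕ → Pred Word 0ℓ
𝔖 n σ = σ ↭ map suc (upTo n)

infix 4 _≡ᴮ_

data _≡ᴮ_ : Rel Word 0ℓ where
  bell     : ∀ {a b c} {u : Word} → a < b → b < c → All (_< b) u →
            b ∷ u ++ c ∷ a ∷ [] ≡ᴮ b ∷ u ++ a ∷ c ∷ []
  ≡ᴮ-refl  : ∀ {v} → v ≡ᴮ v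
  ≡ᴮ-sym   : ∀ {v w} → v ≡ᴮ w → w ≡ᴮ v
  ≡ᴮ-trans : ∀ {v w z} → v ≡ᴮ w → w ≡ᴮ z → v ≡ᴮ z
  ++-cong  : ∀ {v v′ w w′} → v ≡ᴮ v′ → w ≡ᴮ w′ → v ++ w ≡ᴮ v′ ++ w′

BellClass : ℕ → Word → Pred Word 0ℓ
BellClass n σ τ = τ ∈ 𝔖 n × σ ≡ᴮ τ

data Exchange : Rel Word 0ℓ where
  exchange : ∀ (u v : Word) {a b} → a < b →
             Exchange (u ++ a ∷ b ∷ v) (u ++ b ∷ a ∷ v)

infix 4 _≤ᴿ_

_≤ᴿ_ : Rel Word 0ℓ
_≤ᴿ_ = Star Exchange

Interval : ℕ → Word → Word → Pred Word 0ℓ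
Interval n α ω τ = τ ∈ 𝔖 n × α ≤ᴿ τ × τ ≤ᴿ ω

IsInterval : ℕ → Pred Word 0ℓ → Set
IsInterval n C = ∃₂ λ α ω → α ∈ 𝔖 n × ω ∈ 𝔖 n × C ≐ Interval n α ω

MaximalIn : Pred Word 0ℓ → Pred Word 0ℓ
MaximalIn C τ = τ ∈ C × (∀ {ρ} → ρ ∈ C → τ ≤ᴿ ρ → τ ≡ ρ)

Avoids21-3 : Pred Word 0ℓ
Avoids21-3 σ =
  ¬ (Σ[ i ∈ Fin (length σ) ] Σ[ i+1 ∈ Fin (length σ) ] Σ[ j ∈ Fin (length σ) ]
       toℕ i+1 ≡ suc (toℕ i) × toℕ i+1 < toℕ j ×
       lookup σ i+1 < lookup σ i × lookup σ i < lookup σ j)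

-- Blocks are meant to be nonempty and pairwise disjoint (not enforced by the type);
-- neither the order of the blocks nor the order within a block carries meaning.
Block SetPartition : Set
Block        = List ℕ
SetPartition = List Block

-- Blocks are nonempty, so the default 0 never exceeds the true maximum.
blockMax : Block → ℕ
blockMax = max 0

insertLetter : SetPartition → ℕ → SetPartition
insertLetter S w = go (filter (λ B → blockMax B <? w) S)
  where
  go : List Block → SetPartition
  go []       = (w ∷ []) ∷ S
  go (C ∷ Cs) = map (λ B → if does (≡-dec _≟_ B best) then w ∷ B else B) S
    where best = argmax blockMax C Cs

PSA : Word → SetPartition
PSA = foldl insertLetter []

-- `ImmediatelyLeft S t s`: t is the next block to the left of s when the blocks
-- of S are arranged by decreasing maxima.
ImmediatelyLeft : SetPartition → Rel Block 0ℓ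
ImmediatelyLeft S t s =
  t ∈ₗ S × s ∈ₗ S × blockMax s < blockMax t ×
  (∀ {r} → r ∈ₗ S → ¬ (blockMax s < blockMax r × blockMax r < blockMax t))

GreatestBelow : ℕ → Block → Pred ℕ 0ℓ
GreatestBelow x s x′ = x′ ∈ₗ s × x′ < x × (∀ {y} → y ∈ₗ s → y < x → y ≤ x′)

SmallestAbove : ℕ → Block → Pred ℕ 0ℓ
SmallestAbove x t x″ = x″ ∈ₗ t × x < x″ × (∀ {y} → y ∈ₗ t → x < y → x″ ≤ y)

-- `PStep S y x` is a generating relation y <_P x.
data PStep (S : SetPartition) : Rel ℕ 0ℓ where
  sameBlock : ∀ {s x x′} → s ∈ₗ S → x ∈ₗ s → GreatestBelow x s x′ → PStep S x′ x
  leftBlock : ∀ {s t x x″} → ImmediatelyLeft S t s → x ∈ₗ s →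
              SmallestAbove x t x″ → PStep S x″ x

P : SetPartition → Rel ℕ 0ℓ
P S = Star (PStep S)

Precedes : Word → Rel ℕ 0ℓ
Precedes τ x y =
  Σ[ i ∈ Fin (length τ) ] Σ[ j ∈ Fin (length τ) ]
    toℕ i < toℕ j × lookup τ i ≡ x × lookup τ j ≡ y

LinearExtensions : ℕ → Rel ℕ 0ℓ → Pred Word 0ℓ
LinearExtensions n _≤P_ τ =
  τ ∈ 𝔖 n × (∀ {x y} → x ≤P y → x ≢ y → Precedes τ x y)

{-# OPTIONS --safe #-}

-- PSA is patience sorting: the block of a letter x, counted from the left, is given by the
-- length f x of the longest decreasing subsequence ending in x.  This ranking f determines
-- P(σ), is invariant under the Bell relations, and conversely every linear extension of P(σ)
-- has the same ranking as σ.  Applying b u a c → b u c a as long as possible ends in a permutation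
-- avoiding 21-3, and such a permutation is sorted by (f x, x); so each ranking belongs to one
-- Bell class, with a unique maximum.  Going down, exchange adjacent c > a whenever c <_P a is
-- not a generating relation: in the end adjacent descents are relations of P(σ), and since
-- z <_P x with x < y < z implies z <_P y or y <_P x, so are all inversions, which determines
-- the minimum.  A permutation between the minimum and the maximum inherits the relations
-- z <_P x from the former if z > x and from the latter if z < x.

module Submission where

open import Defs
open import Data.Nat using (ℕ)
open import Data.Product using (_×_; ∃-syntax)
open import Relation.Unary using (_∈_; _≐_)

open import Data.Empty using (⊥-elim)
open import Data.Bool using (if_then_else_)
open import Data.Fin using (Fin; zero; suc; toℕ)
open import Data.List
  using ([]; _∷_; [_]; _++_; _∷ʳ_; length; lookup; map; filter; foldl)
open import Data.List.Extrema.Nat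
  using (argmax; argmax-sel; v≤f[argmax]⁺; min; argmin-sel; min≤xs; max; max≤v⁺; ⊥≤max; xs≤max; v≤max⁺)
open import Data.List.Membership.Propositional
  using (find; lose) renaming (_∈_ to _∈ₗ_; _∉_ to _∉ₗ_)
open import Data.List.Membership.Propositional.Properties
  using (∈-++⁺ˡ; ∈-++⁺ʳ; ∈-++⁻; ∈-insert; ∈-∃++; ∈-filter⁺; ∈-filter⁻; ∈-lookup)
open import Data.List.Properties
  using (++-assoc; ++-identityʳ; filter-accept; filter-reject; filter-all; filter-none; filter-++;
         ≡-dec; map-++; length-++)
open import Data.List.Relation.Binary.Permutation.Propositional
  using (_↭_; ↭-sym; ↭-trans; ↭-refl; refl; swap; ↭⇒↭ₛ)
open import Data.List.Relation.Binary.Permutation.Propositional.Properties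
  using (∈-resp-↭; ↭-length; filter-↭; drop-∷; ¬x∷xs↭[]; ++⁺ˡ)
import Data.List.Relation.Binary.Permutation.Setoid.Properties as Permutation
open import Data.List.Relation.Unary.All as All using (All; []; _∷_)
import Data.List.Relation.Unary.All.Properties as All
open import Data.List.Relation.Unary.AllPairs using (AllPairs; []; _∷_)
open import Data.List.Relation.Unary.Any using (Any; here; there; any?; index)
open import Data.List.Relation.Unary.Any.Properties as Any using (lookup-index)
open import Data.List.Relation.Unary.Linked as Linked using (Linked; []; [-]; _∷_)
open import Data.List.Relation.Unary.Unique.Propositional using (Unique)
import Data.List.Relation.Unary.Unique.Propositional.Properties as Unique
open import Data.Nat
  using (zero; suc; _+_; _<_; _≤_; _<?_; _≤?_; _≟_; z≤n; s≤s; s<s⁻¹; s≤s⁻¹)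
open import Data.Nat.Induction using (<-wellFounded)
open import Data.Nat.Properties
open import Data.Product using (_,_; proj₁; proj₂; Σ-syntax)
open import Data.Sum as Sum using (_⊎_; inj₁; inj₂; [_,_]′)
open import Function using (_∘_; id)
open import Induction.WellFounded using (Acc; acc)
open import Level using (0ℓ)
open import Relation.Binary using (Rel; tri<; tri≈; tri>) renaming (Decidable to Decidable₂)
open import Relation.Binary.Construct.Closure.ReflexiveTransitive as Star using (Star; ε; _◅_; _◅◅_)
open import Relation.Binary.PropositionalEquality
  using (_≡_; _≢_; refl; sym; cong; cong₂; subst; subst₂; setoid; module ≡-Reasoning)
  renaming (trans to ≡-trans)
open import Relation.Nullary using (¬_; Dec; yes; no; does; contradiction; _×-dec_)

private
  variable
    a b c d e x y z : ℕ
    p q u v w σ τ ρ : Word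
    f : ℕ → ℕ

-- Order of letters in a word

data Before : Word → Rel ℕ 0ℓ where
  here  : y ∈ₗ w → Before (x ∷ w) x y
  there : Before w x y → Before (z ∷ w) x y

before⇒∈ˡ : Before w x y → x ∈ₗ w
before⇒∈ˡ (here _)  = here refl
before⇒∈ˡ (there r) = there (before⇒∈ˡ r)

before⇒∈ʳ : Before w x y → y ∈ₗ w
before⇒∈ʳ (here y∈w) = there y∈w
before⇒∈ʳ (there r)  = there (before⇒∈ʳ r)

before-irrefl : Unique w → ¬ Before w x x
before-irrefl U       (here x∈w) = Unique.Unique[x∷xs]⇒x∉xs U x∈w
before-irrefl (_ ∷ U) (there r)  = before-irrefl U r

before-asym : Unique w → Before w x y → ¬ Before w y x
before-asym U       (here x∈w) (here _)  = Unique.Unique[x∷xs]⇒x∉xs U x∈w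
before-asym U       (here _)   (there r) = Unique.Unique[x∷xs]⇒x∉xs U (before⇒∈ʳ r)
before-asym U       (there r)  (here _)  = Unique.Unique[x∷xs]⇒x∉xs U (before⇒∈ʳ r)
before-asym (_ ∷ U) (there r)  (there s) = before-asym U r s

before-trans : Unique w → Before w x y → Before w y z → Before w x z
before-trans U       (here x∈w) (here z∈w) = here z∈w
before-trans U       (here _)   (there s)  = here (before⇒∈ʳ s)
before-trans U       (there r)  (here _)   = contradiction (before⇒∈ʳ r) (Unique.Unique[x∷xs]⇒x∉xs U)
before-trans (_ ∷ U) (there r)  (there s)  = there (before-trans U r s)

before-total : x ∈ₗ w → y ∈ₗ w → x ≢ y → Before w x y ⊎ Before w y x
before-total (here refl)  (here refl)  x≢y = contradiction refl x≢y
before-total (here refl)  (there y∈w)  x≢y = inj₁ (here y∈w)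
before-total (there x∈w)  (here refl)  x≢y = inj₂ (here x∈w)
before-total (there x∈w)  (there y∈w)  x≢y =
  [ inj₁ ∘ there , inj₂ ∘ there ]′ (before-total x∈w y∈w x≢y)

before-++ : x ∈ₗ p → y ∈ₗ q → Before (p ++ q) x y
before-++ {p = _ ∷ p} (here refl) y∈q = here (∈-++⁺ʳ p y∈q)
before-++             (there x∈p) y∈q = there (before-++ x∈p y∈q)

before-++⁺ˡ : Before p x y → Before (p ++ q) x y
before-++⁺ˡ (here y∈p) = here (∈-++⁺ˡ y∈p)
before-++⁺ˡ (there r)  = there (before-++⁺ˡ r)

before-++⁺ʳ : ∀ p → Before q x y → Before (p ++ q) x y
before-++⁺ʳ []      r = r
before-++⁺ʳ (_ ∷ p) r = there (before-++⁺ʳ p r)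

before-∷ʳ⁻ : ∀ p → Before (p ∷ʳ z) x y → Before p x y ⊎ (x ∈ₗ p × y ≡ z)
before-∷ʳ⁻ []      (there ())
before-∷ʳ⁻ (_ ∷ p) (here y∈) with ∈-++⁻ p y∈
... | inj₁ y∈p         = inj₁ (here y∈p)
... | inj₂ (here refl) = inj₂ (here refl , refl)
before-∷ʳ⁻ (_ ∷ p) (there r) with before-∷ʳ⁻ p r
... | inj₁ s           = inj₁ (there s)
... | inj₂ (x∈p , y≡z) = inj₂ (there x∈p , y≡z)

before-prefix : ∀ p → Unique (p ++ x ∷ q) → Before (p ++ x ∷ q) y x → y ∈ₗ p
before-prefix []      U       (here x∈q) = contradiction x∈q (Unique.Unique[x∷xs]⇒x∉xs U)
before-prefix []      U       (there r)  = contradiction (before⇒∈ʳ r) (Unique.Unique[x∷xs]⇒x∉xs U)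
before-prefix (_ ∷ p) _       (here _)   = here refl
before-prefix (_ ∷ p) (_ ∷ U) (there r)  = there (before-prefix p U r)

swap-↭ : ∀ p → p ++ a ∷ c ∷ q ↭ p ++ c ∷ a ∷ q
swap-↭ p = ++⁺ˡ p (swap _ _ refl)

before-swap : ∀ p → Before (p ++ a ∷ c ∷ q) x y →
              (x ≡ a × y ≡ c) ⊎ Before (p ++ c ∷ a ∷ q) x y
before-swap []      (here (here refl)) = inj₁ (refl , refl)
before-swap []      (here (there y∈q)) = inj₂ (there (here y∈q))
before-swap []      (there (here y∈q)) = inj₂ (here (there y∈q))
before-swap []      (there (there r))  = inj₂ (there (there r))
before-swap (_ ∷ p) (here y∈)          = inj₂ (here (∈-resp-↭ (swap-↭ p) y∈))
before-swap (_ ∷ p) (there r)          = [ inj₁ , inj₂ ∘ there ]′ (before-swap p r)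

Unique-resp-↭ : v ↭ w → Unique v → Unique w
Unique-resp-↭ = Permutation.Unique-resp-↭ (setoid ℕ) ∘ ↭⇒↭ₛ

-- If the first letters differ, each precedes the other in the word that it heads, a conflict; equal
-- first letters are dropped.
concordant⇒≡ : v ↭ w → (∀ {x y} → Before v x y → ¬ Before w y x) → v ≡ w
concordant⇒≡ {[]}    {[]}    _ _ = refl
concordant⇒≡ {[]}    {_ ∷ _} s _ = contradiction (↭-sym s) ¬x∷xs↭[]
concordant⇒≡ {_ ∷ _} {[]}    s _ = contradiction s ¬x∷xs↭[]
concordant⇒≡ {x ∷ v} {y ∷ w} s ok with x ≟ y
... | yes refl = cong (x ∷_) (concordant⇒≡ (drop-∷ s) λ r r′ → ok (there r) (there r′))
... | no x≢y   = ⊥-elim (ok (here (tail (x≢y ∘ sym) (∈-resp-↭ (↭-sym s) (here refl))))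
                            (here (tail x≢y (∈-resp-↭ s (here refl)))))
  where
  tail : ∀ {x y w} → x ≢ y → x ∈ₗ y ∷ w → x ∈ₗ w
  tail x≢y (here x≡y)  = contradiction x≡y x≢y
  tail x≢y (there x∈w) = x∈w

before⇒precedes : Before τ x y → Precedes τ x y
before⇒precedes (here y∈w) = zero , suc (index y∈w) , s≤s z≤n , refl , sym (lookup-index y∈w)
before⇒precedes (there r) with before⇒precedes r
... | i , j , i<j , eqi , eqj = suc i , suc j , s≤s i<j , eqi , eqj

precedes⇒before : ∀ τ → Precedes τ x y → Before τ x y
precedes⇒before (_ ∷ τ) (zero  , suc j , _   , refl , refl) = here (∈-lookup j)
precedes⇒before (_ ∷ τ) (suc i , suc j , i<j , eqi  , eqj)  =
  there (precedes⇒before τ (i , j , s<s⁻¹ i<j , eqi , eqj))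

-- The right weak order

-- The one pair that an exchange reorders is increasing before it and decreasing after it.
exchange-inversion : Exchange τ ρ → y < x → Before τ x y → Before ρ x y
exchange-inversion (exchange p _ a<b) y<x r with before-swap p r
... | inj₁ (refl , refl) = contradiction a<b (<-asym y<x)
... | inj₂ s             = s

exchange-noninversion : Exchange τ ρ → x < y → Before ρ x y → Before τ x y
exchange-noninversion (exchange p _ a<b) x<y r with before-swap p r
... | inj₁ (refl , refl) = contradiction a<b (<-asym x<y)
... | inj₂ s             = s

≤ᴿ-inversion : τ ≤ᴿ ρ → y < x → Before τ x y → Before ρ x y
≤ᴿ-inversion ε        y<x r = r
≤ᴿ-inversion (s ◅ ss) y<x r = ≤ᴿ-inversion ss y<x (exchange-inversion s y<x r)

≤ᴿ-noninversion : τ ≤ᴿ ρ → x < y → Before ρ x y → Before τ x y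
≤ᴿ-noninversion ε        x<y r = r
≤ᴿ-noninversion (s ◅ ss) x<y r = exchange-noninversion s x<y (≤ᴿ-noninversion ss x<y r)

module _ {R : Rel ℕ 0ℓ} (R? : Decidable₂ R) where

  countPairs : Word → ℕ
  countPairs []      = 0
  countPairs (x ∷ w) = length (filter (R? x) w) + countPairs w

  -- Only the pair of `a` and `c` changes its order; each letter of `p` sees the same letters after
  -- it, permuted.
  countPairs-swap : ∀ p → R a c → ¬ R c a →
                    countPairs (p ++ a ∷ c ∷ q) ≡ suc (countPairs (p ++ c ∷ a ∷ q))
  countPairs-swap {a} {c} {q} [] Rac ¬Rca
    rewrite filter-accept (R? a) {xs = q} Rac | filter-reject (R? c) {xs = q} ¬Rca
    = cong suc (m+[n+o]≡n+[m+o] (length (filter (R? a) q)) (length (filter (R? c) q)) (countPairs q))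
    where
    m+[n+o]≡n+[m+o] : ∀ m n o → m + (n + o) ≡ n + (m + o)
    m+[n+o]≡n+[m+o] m n o =
      ≡-trans (sym (+-assoc m n o)) (≡-trans (cong (_+ o) (+-comm m n)) (+-assoc n m o))
  countPairs-swap (z ∷ p) Rac ¬Rca = ≡-trans
    (cong₂ _+_ (↭-length (filter-↭ (R? z) (swap-↭ p))) (countPairs-swap p Rac ¬Rca))
    (+-suc _ _)

-- `ascents` counts all increasing pairs, adjacent or not. The two numbers serve as termination
-- measures for moving down and up in the weak order.
inversions ascents : Word → ℕ
inversions = countPairs (λ x y → y <? x)
ascents    = countPairs _<?_

inversions< : Exchange τ ρ → inversions τ < inversions ρ
inversions< (exchange p _ a<b) = ≤-reflexive (sym (countPairs-swap (λ x y → y <? x) p a<b (<-asym a<b)))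

ascents< : Exchange τ ρ → ascents ρ < ascents τ
ascents< (exchange p _ a<b) = ≤-reflexive (sym (countPairs-swap _<?_ p a<b (<-asym a<b)))

≤ᴿ⇒≡⊎inversions< : τ ≤ᴿ ρ → τ ≡ ρ ⊎ inversions τ < inversions ρ
≤ᴿ⇒≡⊎inversions< ε = inj₁ refl
≤ᴿ⇒≡⊎inversions< (s ◅ ss) with ≤ᴿ⇒≡⊎inversions< ss
... | inj₁ refl = inj₂ (inversions< s)
... | inj₂ lt   = inj₂ (<-trans (inversions< s) lt)

≤ᴿ-antisym : τ ≤ᴿ ρ → ρ ≤ᴿ τ → τ ≡ ρ
≤ᴿ-antisym s t with ≤ᴿ⇒≡⊎inversions< s | ≤ᴿ⇒≡⊎inversions< t
... | inj₁ eq | _        = eq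
... | inj₂ _  | inj₁ eq  = sym eq
... | inj₂ lt | inj₂ lt′ = contradiction lt (<-asym lt′)

-- Rankings

-- This pins f down on τ: levels start at 0, so f x is one less than the length of the longest
-- decreasing subsequence of τ ending in x.
record Ranking (f : ℕ → ℕ) (τ : Word) : Set where
  field
    unique : Unique τ
    lower  : Before τ y x → x < y → f y < f x
    attain : x ∈ₗ τ → f x ≡ 0 ⊎ ∃[ y ] (Before τ y x × x < y × suc (f y) ≡ f x)

open Ranking

-- A letter b of this kind makes the level of a exceed that of c whichever of the two comes
-- first, so adjacent letters a < c after p can be exchanged without changing the ranking.
Commute : (ℕ → ℕ) → Word → Rel ℕ 0ℓ
Commute f p a c = Any (λ b → a < b × f c ≤ f b) p

-- The only new decreasing pair is `c` before `a`, and the letter `b` of `Commute` gives f c ≤ f b <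
-- f a. The only lost pair is increasing, so every witness of `attain` survives.
ranking-ascend : ∀ p → a < c → Commute f p a c →
                 Ranking f (p ++ a ∷ c ∷ q) → Ranking f (p ++ c ∷ a ∷ q)
ranking-ascend p a<c m R .unique = Unique-resp-↭ (swap-↭ p) (unique R)
ranking-ascend p a<c m R .lower r x<y with before-swap p r
... | inj₂ s             = lower R s x<y
... | inj₁ (refl , refl) with find m
...   | b , b∈p , a<b , fc≤fb = ≤-<-trans fc≤fb (lower R (before-++ b∈p (here refl)) a<b)
ranking-ascend p a<c m R .attain x∈ with attain R (∈-resp-↭ (↭-sym (swap-↭ p)) x∈)
... | inj₁ fx≡0               = inj₁ fx≡0
... | inj₂ (y , r , x<y , eq) with before-swap p r
...   | inj₁ (refl , refl)    = contradiction a<c (<-asym x<y)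
...   | inj₂ s                = inj₂ (y , s , x<y , eq)

-- The only lost decreasing pair is `c` before `a`. If `c` was the witness for `a`, then `b`
-- replaces it, since f b < f a = f c + 1 ≤ f b + 1.
ranking-descend : ∀ p → a < c → Commute f p a c →
                  Ranking f (p ++ c ∷ a ∷ q) → Ranking f (p ++ a ∷ c ∷ q)
ranking-descend p a<c m R .unique = Unique-resp-↭ (swap-↭ p) (unique R)
ranking-descend p a<c m R .lower r x<y with before-swap p r
... | inj₂ s             = lower R s x<y
... | inj₁ (refl , refl) = contradiction a<c (<-asym x<y)
ranking-descend p a<c m R .attain x∈ with attain R (∈-resp-↭ (↭-sym (swap-↭ p)) x∈)
... | inj₁ fx≡0               = inj₁ fx≡0
... | inj₂ (y , r , x<y , eq) with before-swap p r
...   | inj₂ s                = inj₂ (y , s , x<y , eq)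
...   | inj₁ (refl , refl)    with find m
...     | b , b∈p , a<b , fc≤fb = inj₂ (b , before-++ b∈p (here refl) , a<b ,
            ≤-antisym (lower R (before-++ b∈p (there (here refl))) a<b)
                      (≤-trans (≤-reflexive (sym eq)) (s≤s fc≤fb)))

-- A witness y for the level of `c` exceeds `c`, so it is neither `b` nor in `u` and must lie in
-- `p`. Being greater than `b` as well, it forces f b > f y = f c - 1.
bell-level : ∀ p u → w ≡ p ++ b ∷ u ++ c ∷ q → b < c → All (_< c) u → Ranking f w → f c ≤ f b
bell-level {b = b} {c} {q} {f} p u refl b<c u<c R with attain R (∈-++⁺ʳ p (there (∈-insert u)))
... | inj₁ fc≡0 = ≤-trans (≤-reflexive fc≡0) z≤n
... | inj₂ (y , r , c<y , eq)
    with ∈-++⁻ p (before-prefix (p ++ b ∷ u) (subst Unique assoc (unique R)) (subst (λ w → Before w y c) assoc r))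
  where assoc = sym (++-assoc p (b ∷ u) (c ∷ q))
...   | inj₁ y∈p         = ≤-trans (≤-reflexive (sym eq)) (lower R (before-++ y∈p (here refl)) (<-trans b<c c<y))
...   | inj₂ (here refl) = contradiction b<c (<-asym c<y)
...   | inj₂ (there y∈u) = contradiction (All.lookup u<c y∈u) (<-asym c<y)

-- The Bell congruence

-- A single Bell relation in a context, oriented upward in the weak order.
data BellUp : Rel Word 0ℓ where
  bellUp : ∀ p u {a b c q} → a < b → b < c → All (_< b) u →
           BellUp (p ++ b ∷ u ++ a ∷ c ∷ q) (p ++ b ∷ u ++ c ∷ a ∷ q)

bellUp-ranking : BellUp τ ρ → (Ranking f τ → Ranking f ρ) × (Ranking f ρ → Ranking f τ)
bellUp-ranking {f = f} (bellUp p u {a} {b} {c} {q} a<b b<c u<b) =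
    (λ R → subst (Ranking f) (++-assoc p (b ∷ u) _)
             (ranking-ascend (p ++ b ∷ u) a<c
               -- In the lower word `a` also stands between `b` and `c`; it is smaller than `c` too.
               (commute (bell-level p (u ∷ʳ a) (cong (λ w → p ++ b ∷ w) (sym (++-assoc u [ a ] _)))
                                    b<c (All.∷ʳ⁺ u<c a<c) R))
               (subst (Ranking f) (sym (++-assoc p (b ∷ u) _)) R)))
  , (λ R → subst (Ranking f) (++-assoc p (b ∷ u) _)
             (ranking-descend (p ++ b ∷ u) a<c
               (commute (bell-level p u refl b<c u<c R))
               (subst (Ranking f) (sym (++-assoc p (b ∷ u) _)) R)))
  where
  a<c = <-trans a<b b<c
  u<c = All.map (λ x<b → <-trans x<b b<c) u<b
  commute : f c ≤ f b → Commute f (p ++ b ∷ u) a c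
  commute fc≤fb = lose (∈-insert p) (a<b , fc≤fb)

-- Quantifying over the context lets the case `++-cong` replace `v` and then `w`; having both
-- directions settles `≡ᴮ-sym`.
≡ᴮ-ranking : v ≡ᴮ w → ∀ p q →
             (Ranking f (p ++ v ++ q) → Ranking f (p ++ w ++ q)) ×
             (Ranking f (p ++ w ++ q) → Ranking f (p ++ v ++ q))
≡ᴮ-ranking {f = f} (bell {a} {b} {c} {u} a<b b<c u<b) p q
  rewrite ++-assoc u (c ∷ a ∷ []) q | ++-assoc u (a ∷ c ∷ []) q
  = proj₂ up , proj₁ up
  where up = bellUp-ranking {f = f} (bellUp p u {q = q} a<b b<c u<b)
≡ᴮ-ranking ≡ᴮ-refl _ _ = id , id
≡ᴮ-ranking (≡ᴮ-sym s)       p q = proj₂ (≡ᴮ-ranking s p q) , proj₁ (≡ᴮ-ranking s p q)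
≡ᴮ-ranking (≡ᴮ-trans s t)   p q =
    proj₁ (≡ᴮ-ranking t p q) ∘ proj₁ (≡ᴮ-ranking s p q)
  , proj₂ (≡ᴮ-ranking s p q) ∘ proj₂ (≡ᴮ-ranking t p q)
≡ᴮ-ranking (++-cong {v} {v′} {w} {w′} s t) p q
  rewrite ++-assoc v w q | ++-assoc v′ w′ q
        | sym (++-assoc p v′ (w′ ++ q))
        = (λ R → proj₁ tail (subst (Ranking _) (sym (++-assoc p v′ (w ++ q))) (proj₁ head R)))
        , (λ R → proj₂ head (subst (Ranking _) (++-assoc p v′ (w ++ q)) (proj₂ tail R)))
  where
  head = ≡ᴮ-ranking s p (w ++ q)
  tail = ≡ᴮ-ranking t (p ++ v′) q

bellUp⇒≡ᴮ : BellUp τ ρ → τ ≡ᴮ ρ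
bellUp⇒≡ᴮ (bellUp p u {a} {b} {c} {q} a<b b<c u<b) =
  ++-cong (≡ᴮ-refl {p}) (subst₂ _≡ᴮ_ (cong (b ∷_) (++-assoc u _ q)) (cong (b ∷_) (++-assoc u _ q))
    (++-cong (≡ᴮ-sym (bell a<b b<c u<b)) (≡ᴮ-refl {q})))

bellUp⇒exchange : BellUp τ ρ → Exchange τ ρ
bellUp⇒exchange (bellUp p u {a} {b} {c} {q} a<b b<c _) =
  subst₂ Exchange (++-assoc p (b ∷ u) _) (++-assoc p (b ∷ u) _)
    (exchange (p ++ b ∷ u) q (<-trans a<b b<c))

exchange⇒↭ : Exchange τ ρ → τ ↭ ρ
exchange⇒↭ (exchange p _ _) = swap-↭ p

-- The order generated by a ranking

-- The generators of P(σ) in terms of levels, with levels in the role of blocks. `sameLevel` relates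
-- any two letters of a level, not only neighbours, and `A` matters only through its set of letters.
data Step (f : ℕ → ℕ) (A : Word) : Rel ℕ 0ℓ where
  sameLevel : y ∈ₗ A → x ∈ₗ A → f y ≡ f x → y < x → Step f A y x
  nextLevel : y ∈ₗ A → x ∈ₗ A → suc (f y) ≡ f x → x < y →
              (∀ {z} → z ∈ₗ A → f z ≡ f y → x < z → y ≤ z) → Step f A y x

Order : (ℕ → ℕ) → Word → Rel ℕ 0ℓ
Order f A = Star (Step f A)

step⇒∈ˡ : Step f w y x → y ∈ₗ w
step⇒∈ˡ (sameLevel y∈ _ _ _)   = y∈
step⇒∈ˡ (nextLevel y∈ _ _ _ _) = y∈

step-resp-↭ : v ↭ w → Step f v y x → Step f w y x
step-resp-↭ s (sameLevel y∈ x∈ eq y<x) = sameLevel (∈-resp-↭ s y∈) (∈-resp-↭ s x∈) eq y<x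
step-resp-↭ s (nextLevel y∈ x∈ eq x<y least) =
  nextLevel (∈-resp-↭ s y∈) (∈-resp-↭ s x∈) eq x<y (least ∘ ∈-resp-↭ (↭-sym s))

-- `attain` supplies one greater letter on the preceding level; the least of them gives a generating
-- relation.
parent : Ranking f τ → x ∈ₗ τ → ∀ {k} → f x ≡ suc k → ∃[ y ] (f y ≡ k × x < y × Step f τ y x)
parent {f} {τ} {x} R x∈ {k} eq with attain R x∈
... | inj₁ fx≡0               = contradiction (≡-trans (sym fx≡0) eq) λ ()
... | inj₂ (y , r , x<y , eq′) = m , proj₂ m-good , proj₁ m-good ,
      nextLevel (proj₁ (∈-filter⁻ good? m∈)) x∈ (≡-trans (cong suc (proj₂ m-good)) (sym eq)) (proj₁ m-good)
        λ z∈ fz≡fm x<z → All.lookup (min≤xs y candidates)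
          (∈-filter⁺ good? z∈ (x<z , ≡-trans fz≡fm (proj₂ m-good)))
  where
  good? = λ z → (x <? z) ×-dec (f z ≟ k)
  candidates = filter good? τ
  y∈ : y ∈ₗ candidates
  y∈ = ∈-filter⁺ good? (before⇒∈ˡ r) (x<y , suc-injective (≡-trans eq′ eq))
  -- The default `y` is itself a candidate, so the minimum is one in either case.
  m = min y candidates
  m∈ : m ∈ₗ candidates
  m∈ = [ (λ eq → subst (_∈ₗ candidates) (sym eq) y∈) , id ]′ (argmin-sel id y candidates)
  m-good = proj₂ (∈-filter⁻ good? {xs = τ} m∈)

climb : Ranking f τ → x ∈ₗ τ → ∀ d {k} → f x ≡ d + k →
        ∃[ z ] (z ∈ₗ τ × f z ≡ k × x ≤ z × Order f τ z x)
climb R x∈ zero    eq = _ , x∈ , eq , ≤-refl , ε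
climb R x∈ (suc d) eq with parent R x∈ eq
... | y , eq′ , x<y , s with climb R (step⇒∈ˡ s) d eq′
...   | z , z∈ , fz≡k , y≤z , ss = z , z∈ , fz≡k , <⇒≤ (<-≤-trans x<y y≤z) , ss ◅◅ (s ◅ ε)

climb≤ : Ranking f τ → x ∈ₗ τ → ∀ {k} → k ≤ f x → ∃[ z ] (z ∈ₗ τ × f z ≡ k × x ≤ z × Order f τ z x)
climb≤ R x∈ k≤fx = climb R x∈ _ (sym (m∸n+n≡m k≤fx))

-- Climbing from `x` to the level of `y` reaches a letter z ≥ x > y, which lies above `y` by
-- `sameLevel`.
level≤∧<⇒order : Ranking f τ → y ∈ₗ τ → x ∈ₗ τ → f y ≤ f x → y < x → Order f τ y x
level≤∧<⇒order R y∈ x∈ fy≤fx y<x with climb≤ R x∈ fy≤fx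
... | z , z∈ , fz≡fy , x≤z , ss = sameLevel y∈ z∈ (sym fz≡fy) (<-≤-trans y<x x≤z) ◅ ss

-- Follow the chain from `z` as long as its letters stay above `y`. It either meets `y` or jumps
-- across it by a `nextLevel` step, where comparing levels decides between the alternatives.
order-between : Ranking f τ → y ∈ₗ τ → x < y → y < z → Order f τ z x → Order f τ z y ⊎ Order f τ y x
order-between R y∈ x<y y<z ε = contradiction x<y (<-asym y<z)
order-between R y∈ x<y y<z (s@(sameLevel _ _ _ z<w) ◅ ss) with order-between R y∈ x<y (<-trans y<z z<w) ss
... | inj₁ t = inj₁ (s ◅ t)
... | inj₂ t = inj₂ t
order-between {f} {y = y} R y∈ x<y y<z (_◅_ {j = w} s@(nextLevel z∈ w∈ eq w<z _) ss) with <-cmp y w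
... | tri≈ _ refl _ = inj₁ (s ◅ ε)
... | tri< y<w _ _  with order-between R y∈ x<y y<w ss
...   | inj₁ t      = inj₁ (s ◅ t)
...   | inj₂ t      = inj₂ t
-- The step jumps across `y`: if f y ≤ f z then `y` is below `z` in the order, otherwise f w = f z +
-- 1 ≤ f y and `w` is below `y`.
order-between {f} {y = y} R y∈ x<y y<z (_◅_ {z} s@(nextLevel z∈ w∈ eq w<z _) ss) | tri> _ _ w<y
  with f y ≤? f z
... | yes fy≤fz = inj₂ (level≤∧<⇒order R y∈ z∈ fy≤fz y<z ◅◅ s ◅ ss)
... | no fy≰fz  = inj₁ (s ◅ level≤∧<⇒order R w∈ y∈ (≤-trans (≤-reflexive (sym eq)) (≰⇒> fy≰fz)) w<y)

Respects : Rel ℕ 0ℓ → Word → Set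
Respects R τ = ∀ {y x} → R y x → Before τ y x

-- In the opposite order `lower` would make the levels differ.
same-level-before : Ranking f τ → y ∈ₗ τ → x ∈ₗ τ → f y ≡ f x → y < x → Before τ y x
same-level-before R y∈ x∈ eq y<x with before-total y∈ x∈ (<⇒≢ y<x)
... | inj₁ r = r
... | inj₂ r = contradiction (sym eq) (<⇒≢ (lower R r y<x))

-- For `nextLevel`, the witness z of `attain` shares the level of `y`, and z ≥ y by leastness. So
-- `y` is z or precedes it, and z precedes `x`.
ranking⇒respects : Ranking f τ → Respects (Step f τ) τ
ranking⇒respects R (sameLevel y∈ x∈ eq y<x) = same-level-before R y∈ x∈ eq y<x
ranking⇒respects {f} R (nextLevel {y} {x} y∈ x∈ eq x<y least) with attain R x∈
... | inj₁ fx≡0 = contradiction (≡-trans eq fx≡0) λ ()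
... | inj₂ (z , r , x<z , eq′) with m≤n⇒m<n∨m≡n (least (before⇒∈ˡ r) fz≡fy x<z)
  where fz≡fy = suc-injective (≡-trans eq′ (sym eq))
...   | inj₂ refl = r
...   | inj₁ y<z  = before-trans (unique R)
                      (same-level-before R y∈ (before⇒∈ˡ r) (suc-injective (≡-trans eq (sym eq′))) y<z) r

order⇒≡⊎before : Unique τ → Respects (Step f v) τ → Order f v y x → y ≡ x ⊎ Before τ y x
order⇒≡⊎before U ok ε = inj₁ refl
order⇒≡⊎before U ok (s ◅ ss) with order⇒≡⊎before U ok ss
... | inj₁ refl = inj₂ (ok s)
... | inj₂ r    = inj₂ (before-trans U (ok s) r)

order⇒¬before : Ranking f τ → Order f τ y x → ¬ Before τ x y
order⇒¬before R ss r with order⇒≡⊎before (unique R) (ranking⇒respects R) ss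
... | inj₁ refl = before-irrefl (unique R) r
... | inj₂ r′   = before-asym (unique R) r r′

-- If `y` preceded a smaller `x` with f x ≤ f y, climbing from `y` to the level of `x` would put `x`
-- below `y` in the order, so `x` would come first. For `attain`, the parent of a letter is a
-- witness.
respects⇒ranking : Ranking f σ → σ ↭ τ → Respects (Step f σ) τ → Ranking f τ
respects⇒ranking R σ↭τ ok .unique = Unique-resp-↭ σ↭τ (unique R)
respects⇒ranking {f = f} {τ = τ} R σ↭τ ok .lower {y} {x} r x<y with f x ≤? f y
... | no fx≰fy  = ≰⇒> fx≰fy
... | yes fx≤fy with climb≤ R (∈-resp-↭ (↭-sym σ↭τ) (before⇒∈ˡ r)) fx≤fy
...   | z , z∈ , fz≡fx , y≤z , ss = contradiction r (before-asym U x-before-y)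
  where
  U = Unique-resp-↭ σ↭τ (unique R)
  x-before-z : Before τ x z
  x-before-z = ok (sameLevel (∈-resp-↭ (↭-sym σ↭τ) (before⇒∈ʳ r)) z∈ (sym fz≡fx) (<-≤-trans x<y y≤z))
  x-before-y : Before τ x y
  x-before-y = [ (λ z≡y → subst (Before τ x) z≡y x-before-z) , before-trans U x-before-z ]′
                 (order⇒≡⊎before U ok ss)
respects⇒ranking {f = f} R σ↭τ ok .attain {x} x∈ with f x in eq
... | zero  = inj₁ refl
... | suc k with parent R (∈-resp-↭ (↭-sym σ↭τ) x∈) eq
...   | y , fy≡k , x<y , s = inj₂ (y , ok s , x<y , cong suc fy≡k)

-- The pattern 21-3 and the maximal elements

data Has21-3 : Word → Set where
  here  : e < d → y ∈ₗ w → d < y → Has21-3 (d ∷ e ∷ w)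
  there : Has21-3 w → Has21-3 (x ∷ w)

has21-3? : ∀ w → Dec (Has21-3 w)
has21-3? []      = no λ ()
has21-3? (d ∷ []) = no λ { (there ()) }
has21-3? (d ∷ e ∷ w) with (e <? d) ×-dec any? (d <?_) w | has21-3? (e ∷ w)
... | yes (e<d , m) | _       = yes (let _ , y∈w , d<y = find m in here e<d y∈w d<y)
... | no _          | yes h   = yes (there h)
... | no ¬here      | no ¬h   = no λ where
      (here e<d y∈w d<y) → ¬here (e<d , lose y∈w d<y)
      (there h)          → ¬h h

avoids⇒¬has21-3 : ∀ w → w ∈ Avoids21-3 → ¬ Has21-3 w
avoids⇒¬has21-3 w av h = av (indices h)
  where
  indices : ∀ {w} → Has21-3 w →
            Σ[ i ∈ Fin (length w) ] Σ[ i+1 ∈ Fin (length w) ] Σ[ j ∈ Fin (length w) ]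
              toℕ i+1 ≡ suc (toℕ i) × toℕ i+1 < toℕ j ×
              lookup w i+1 < lookup w i × lookup w i < lookup w j
  indices (here {d = d} e<d y∈w d<y) =
    zero , suc zero , suc (suc (index y∈w)) , refl , s≤s (s≤s z≤n) , e<d , subst (d <_) (lookup-index y∈w) d<y
  indices (there h) with indices h
  ... | i , i+1 , j , eq , lt , desc , asc = suc i , suc i+1 , suc j , cong suc eq , s≤s lt , desc , asc

¬has21-3⇒avoids : ∀ w → ¬ Has21-3 w → w ∈ Avoids21-3
¬has21-3⇒avoids w ¬h (i , i+1 , j , eq , lt , desc , asc) = ¬h (occurrence w i i+1 j eq lt desc asc)
  where
  occurrence : ∀ w (i i+1 j : Fin (length w)) → toℕ i+1 ≡ suc (toℕ i) → toℕ i+1 < toℕ j →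
               lookup w i+1 < lookup w i → lookup w i < lookup w j → Has21-3 w
  occurrence (d ∷ e ∷ w) zero    (suc zero) (suc (suc j)) _  _  desc asc = here desc (∈-lookup j) asc
  occurrence (d ∷ e ∷ w) zero    (suc zero) (suc zero)    _  (s≤s ()) desc asc
  occurrence (x ∷ w)     (suc i) (suc i+1)  (suc j)       eq lt desc asc =
    there (occurrence w i i+1 j (suc-injective eq) (s<s⁻¹ lt) desc asc)

has21-3-++ : ∀ p → Has21-3 w → Has21-3 (p ++ w)
has21-3-++ []      h = h
has21-3-++ (_ ∷ p) h = there (has21-3-++ p h)

first-greater : ∀ w → d ∉ₗ w → y ∈ₗ w → d < y →
                ∃[ u ] ∃[ z ] ∃[ q ] (w ≡ u ++ z ∷ q × d < z × All (_< d) u)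
first-greater {d} (x ∷ w) d∉ y∈ d<y with <-cmp d x
... | tri< d<x _ _  = [] , x , w , refl , d<x , []
... | tri≈ _ refl _ = contradiction (here refl) d∉
first-greater (x ∷ w) d∉ (here refl) d<y | tri> _ _ x<d = contradiction d<y (<-asym x<d)
first-greater (x ∷ w) d∉ (there y∈)  d<y | tri> _ _ x<d with first-greater w (d∉ ∘ there) y∈ d<y
... | u , z , q , eq , d<z , u<d = x ∷ u , z , q , cong (x ∷_) eq , d<z , x<d ∷ u<d

snoc-view : ∀ e u → Σ[ v ∈ Word ] Σ[ a ∈ ℕ ] (e ∷ u ≡ v ∷ʳ a)
snoc-view e []      = [] , e , refl
snoc-view e (x ∷ u) with snoc-view x u
... | v , a , eq = e ∷ v , a , cong (e ∷_) eq

-- The letter `d` of the pattern plays b, the first later letter above `d` plays c, and the letter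
-- just before that plays a. Since `e` stands in between, this a exists and is smaller than `d`.
has21-3⇒bellUp : Unique τ → Has21-3 τ → ∃[ ρ ] BellUp τ ρ
has21-3⇒bellUp (_ ∷ U) (there {x = x} h) with has21-3⇒bellUp U h
... | _ , bellUp p u a<b b<c u<b = _ , bellUp (x ∷ p) u a<b b<c u<b
has21-3⇒bellUp U (here {e} {d} {w = w} e<d y∈w d<y)
  with first-greater w (Unique.Unique[x∷xs]⇒x∉xs U ∘ there) y∈w d<y
... | u , z , q , refl , d<z , u<d with snoc-view e u
...   | v , a , eq with All.∷ʳ⁻ (subst (All (_< d)) eq (e<d ∷ u<d))
...     | v<d , a<d = _ , subst (λ w → BellUp (d ∷ w) (d ∷ v ++ z ∷ a ∷ q))
            (≡-trans (sym (++-assoc v [ a ] (z ∷ q))) (cong (_++ z ∷ q) (sym eq)))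
            (bellUp [] v a<d d<z v<d)

-- The letters from `z` to `x` cannot increase throughout; the top of the first descent is still
-- below `y`.
has21-3-between : ∀ v → x < z → z < y → All (_< y) v → y ∈ₗ q → Has21-3 (z ∷ v ++ x ∷ q)
has21-3-between []      x<z z<y []          y∈q = here x<z y∈q z<y
has21-3-between {z = z} (d ∷ v) x<z z<y (d<y ∷ v<y) y∈q with d <? z
... | yes d<z = here d<z (∈-++⁺ʳ v (there y∈q)) z<y
... | no d≮z  = there (has21-3-between v (<-≤-trans x<z (≮⇒≥ d≮z)) d<y v<y y∈q)

-- If x precedes y at a higher level, then x < z < y for some z before x at the level of y; by
-- induction on the prefix the letters from z to x are all below y, so a descent among them
-- forms the pattern with y.
avoider-sorted : Ranking f τ → ¬ Has21-3 τ → ∀ p q → τ ≡ p ++ q →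
                 (∀ {x y} → Before p x y → f x ≤ f y) → Before τ x y → f x ≤ f y
avoider-sorted {τ = τ} R ¬h p [] eq sorted r = sorted (subst (λ w → Before w _ _) (≡-trans eq (++-identityʳ p)) r)
avoider-sorted {f} {τ} R ¬h p (y ∷ q) refl sorted =
  avoider-sorted R ¬h (p ∷ʳ y) q (sym (++-assoc p [ y ] q))
    λ r → [ sorted , (λ { (x∈p , refl) → last x∈p }) ]′ (before-∷ʳ⁻ p r)
  where
  last : x ∈ₗ p → f x ≤ f y
  last {x} x∈p with f x ≤? f y
  ... | yes fx≤fy = fx≤fy
  ... | no fx≰fy with climb≤ R (∈-++⁺ˡ x∈p) (<⇒≤ (≰⇒> fx≰fy)) | ∈-∃++ x∈p
  ...   | z , z∈ , fz≡fy , x≤z , ss | p′ , p″ , refl with order⇒≡⊎before (unique R) (ranking⇒respects R) ss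
  ...     | inj₁ refl = contradiction (≤-reflexive fz≡fy) fx≰fy
  ...     | inj₂ z-before-x
      with ∈-∃++ (before-prefix p′ (subst Unique (++-assoc p′ _ _) (unique R))
                                   (subst (λ w → Before w z x) (++-assoc p′ _ _) z-before-x))
  ...       | p₀ , v , refl = contradiction
      (subst Has21-3 (sym split) (has21-3-++ p₀ (has21-3-between v x<z z<y v<y (∈-++⁺ʳ p″ (here refl))))) ¬h
    where
    split : ((p₀ ++ z ∷ v) ++ x ∷ p″) ++ y ∷ q ≡ p₀ ++ z ∷ v ++ x ∷ p″ ++ y ∷ q
    split = ≡-trans (++-assoc (p₀ ++ z ∷ v) _ _) (++-assoc p₀ (z ∷ v) _)
    x<z : x < z
    x<z = ≤∧≢⇒< x≤z λ { refl → fx≰fy (≤-reflexive fz≡fy) }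
    -- If such a letter exceeded `y`, its level would be smaller than f y = f z.
    below : ∀ {t} → t ∈ₗ (p₀ ++ z ∷ v) ++ x ∷ p″ → f z ≤ f t → t < y
    below {t} t∈ fz≤ft with <-cmp t y
    ... | tri< t<y _ _  = t<y
    ... | tri≈ _ refl _ = contradiction (before-++ t∈ (here refl)) (before-irrefl (unique R))
    ... | tri> _ _ y<t  =
      contradiction (lower R (before-++ t∈ (here refl)) y<t) (≤⇒≯ (≤-trans (≤-reflexive (sym fz≡fy)) fz≤ft))
    z<y : z < y
    z<y = below (∈-++⁺ˡ (∈-insert p₀)) ≤-refl
    v<y : All (_< y) v
    v<y = All.tabulate λ {t} t∈v → below (∈-++⁺ˡ (∈-++⁺ʳ p₀ (there t∈v)))
            (sorted (subst (λ w → Before w z t) (sym (++-assoc p₀ _ _)) (before-++⁺ʳ p₀ (here (∈-++⁺ˡ t∈v)))))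

-- Letters in opposite orders have equal levels, as both words are sorted by level; but within a
-- level the order is increasing in both.
avoider-unique : Ranking f σ → Ranking f τ → σ ↭ τ → ¬ Has21-3 σ → ¬ Has21-3 τ → σ ≡ τ
avoider-unique {f} R S σ↭τ ¬hσ ¬hτ = concordant⇒≡ σ↭τ conflict
  where
  conflict : Before _ x y → ¬ Before _ y x
  conflict {x} {y} r s with <-cmp x y
    | ≤-antisym (avoider-sorted R ¬hσ [] _ refl (λ ()) r) (avoider-sorted S ¬hτ [] _ refl (λ ()) s)
  ... | tri< x<y _ _  | eq = <⇒≢ (lower S s x<y) (sym eq)
  ... | tri≈ _ refl _ | eq = before-irrefl (unique R) r
  ... | tri> _ _ y<x  | eq = <⇒≢ (lower R r y<x) eq

record Top (f : ℕ → ℕ) (τ ω : Word) : Set where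
  field
    ranking : Ranking f ω
    above   : τ ≤ᴿ ω
    bellEq  : τ ≡ᴮ ω
    perm    : τ ↭ ω
    avoids  : ¬ Has21-3 ω

top : Ranking f τ → ∃[ ω ] Top f τ ω
top {f} R = go R (<-wellFounded _)
  where
  go : Ranking f τ → Acc _<_ (ascents τ) → ∃[ ω ] Top f τ ω
  go {τ} R (acc rs) with has21-3? τ
  ... | no ¬h = τ , record { ranking = R ; above = ε ; bellEq = ≡ᴮ-refl ; perm = ↭-refl ; avoids = ¬h }
  ... | yes h with has21-3⇒bellUp (unique R) h
  ...   | ρ , up with go (proj₁ (bellUp-ranking up) R) (rs (ascents< (bellUp⇒exchange up)))
  ...     | ω , T = ω , record
            { ranking = Top.ranking T
            ; above   = bellUp⇒exchange up ◅ Top.above T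
            ; bellEq  = ≡ᴮ-trans (bellUp⇒≡ᴮ up) (Top.bellEq T)
            ; perm    = ↭-trans (exchange⇒↭ (bellUp⇒exchange up)) (Top.perm T)
            ; avoids  = Top.avoids T
            }

-- The minimal elements

-- Downward Bell steps alone can get stuck above the minimum, as in 32541, whose class has
-- minimum 32154; hence all exchanges of a Commute pair are used.

-- `A` stays the whole word while the last argument runs through its suffixes.
Settled : (ℕ → ℕ) → Word → Word → Set
Settled f A = Linked (λ c a → a < c → Step f A c a)

-- A witness for the level of `a` other than `c`, or a letter on the level of `c` strictly between
-- `a` and `c`, would lie in `p` and make the pair `Commute`.
unforced : ∀ p → Ranking f (p ++ c ∷ a ∷ q) → a < c → ¬ Commute f p a c → Step f (p ++ c ∷ a ∷ q) c a
unforced {f} {c} {a} {q} p R a<c ¬m = nextLevel c∈ a∈ (level (attain R a∈)) a<c least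
  where
  word = p ++ c ∷ a ∷ q
  assoc = ++-assoc p [ c ] (a ∷ q)
  c∈ : c ∈ₗ word
  c∈ = ∈-insert p
  a∈ : a ∈ₗ word
  a∈ = ∈-++⁺ʳ p (there (here refl))
  fc<fa : f c < f a
  fc<fa = lower R (before-++⁺ʳ p (here (here refl))) a<c
  level : f a ≡ 0 ⊎ ∃[ y ] (Before word y a × a < y × suc (f y) ≡ f a) → suc (f c) ≡ f a
  level (inj₁ fa≡0) = contradiction (≤-trans fc<fa (≤-reflexive fa≡0)) λ ()
  level (inj₂ (y , r , a<y , eq))
    with ∈-++⁻ p (before-prefix (p ∷ʳ c) (subst Unique (sym assoc) (unique R))
                                         (subst (λ w → Before w y a) (sym assoc) r))
  ... | inj₂ (here refl) = eq
  ... | inj₁ y∈p = contradiction (lose y∈p (a<y , s≤s⁻¹ (≤-trans fc<fa (≤-reflexive (sym eq))))) ¬m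
  least : ∀ {z} → z ∈ₗ word → f z ≡ f c → a < z → c ≤ z
  least {z} z∈ eq a<z with c ≤? z
  ... | yes c≤z = c≤z
  ... | no c≰z  = contradiction (lose (before-prefix p (unique R) (same-level-before R z∈ c∈ eq (≰⇒> c≰z)))
                                      (a<z , ≤-reflexive (sym eq))) ¬m

-- The passed letters are kept in `p` because `Commute` depends on the whole prefix.
settle : ∀ p q → Ranking f (p ++ q) →
         Settled f (p ++ q) q ⊎ ∃[ ρ ] (Exchange ρ (p ++ q) × Ranking f ρ)
settle p []      R = inj₁ []
settle p (_ ∷ []) R = inj₁ [-]
settle {f} p (c ∷ a ∷ q) R with settle (p ∷ʳ c) (a ∷ q) (subst (Ranking f) (sym (++-assoc p [ c ] _)) R)
... | inj₂ s rewrite ++-assoc p [ c ] (a ∷ q) = inj₂ s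
... | inj₁ s rewrite ++-assoc p [ c ] (a ∷ q) with a <? c
...   | no a≮c  = inj₁ ((λ a<c → contradiction a<c a≮c) ∷ s)
...   | yes a<c with any? (λ b → (a <? b) ×-dec (f c ≤? f b)) p
...     | yes m = inj₂ (_ , exchange p q a<c , ranking-descend p a<c m R)
...     | no ¬m = inj₁ ((λ _ → unforced p R a<c ¬m) ∷ s)

-- Compare the letter `x` after `b` with both `a` and `b`. The relation of `b` to `x` (if x < b) or
-- of `x` to `a` (by recursion) is prolonged to one from `b` to `a`, or `order-between` yields it;
-- the other alternative of `order-between` contradicts the order of the letters in the word.
settled⇒forced : Ranking f τ → Settled f τ w → Unique w → (∀ {x y} → Before w x y → Before τ x y) →
                 a < b → Before w b a → Order f τ b a
settled⇒forced {w = b ∷ x ∷ w} {a = a} R (s ∷ l) (_ ∷ U) emb a<b (here (here refl)) = s a<b ◅ ε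
settled⇒forced {w = b ∷ x ∷ w} {a = a} R (s ∷ l) (_ ∷ U) emb a<b (here (there a∈w)) with <-cmp x b
... | tri≈ _ refl _ = contradiction (emb (here (here refl))) (before-irrefl (unique R))
... | tri> _ _ b<x
    with settled⇒forced R l U (emb ∘ there) (<-trans a<b b<x) (here a∈w)
...   | x≼a with order-between R (before⇒∈ˡ (emb (here (here refl)))) a<b b<x x≼a
...     | inj₁ x≼b = contradiction (emb (here (here refl))) (order⇒¬before R x≼b)
...     | inj₂ b≼a = b≼a
settled⇒forced {w = b ∷ x ∷ w} {a = a} R (s ∷ l) (_ ∷ U) emb a<b (here (there a∈w)) | tri< x<b _ _
  with <-cmp a x
... | tri< a<x _ _  = s x<b ◅ settled⇒forced R l U (emb ∘ there) a<x (here a∈w)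
... | tri≈ _ refl _ = s x<b ◅ ε
... | tri> _ _ x<a with order-between R (before⇒∈ʳ (emb (here (there a∈w)))) x<a a<b (s x<b ◅ ε)
...   | inj₁ b≼a = b≼a
...   | inj₂ a≼x = contradiction (emb (there (here a∈w))) (order⇒¬before R a≼x)
settled⇒forced {w = b ∷ w} R l (_ ∷ U) emb a<b (there r) = settled⇒forced R (Linked.tail l) U (emb ∘ there) a<b r

-- Every inversion of one word is a relation of the common order, hence respected by the other word.
settled-unique : Ranking f σ → Ranking f τ → σ ↭ τ → Settled f σ σ → Settled f τ τ → σ ≡ τ
settled-unique {f} {σ} {τ} R S σ↭τ sσ sτ = concordant⇒≡ σ↭τ conflict
  where
  respects : Respects (Step f σ) τ
  respects = ranking⇒respects S ∘ step-resp-↭ σ↭τ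
  respects′ : Respects (Step f τ) σ
  respects′ = ranking⇒respects R ∘ step-resp-↭ (↭-sym σ↭τ)
  conflict : Before σ x y → ¬ Before τ y x
  conflict {x} {y} r s with <-cmp x y
  ... | tri≈ _ refl _ = before-irrefl (unique R) r
  ... | tri> _ _ y<x with order⇒≡⊎before (unique S) respects (settled⇒forced R sσ (unique R) id y<x r)
  ...   | inj₁ refl = before-irrefl (unique R) r
  ...   | inj₂ r′   = before-asym (unique S) r′ s
  conflict {x} {y} r s | tri< x<y _ _ with order⇒≡⊎before (unique R) respects′ (settled⇒forced S sτ (unique S) id x<y s)
  ...   | inj₁ refl = before-irrefl (unique R) r
  ...   | inj₂ s′   = before-asym (unique R) s′ r

record Bottom (f : ℕ → ℕ) (τ α : Word) : Set where
  field
    ranking : Ranking f α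
    below   : α ≤ᴿ τ
    perm    : α ↭ τ
    settled : Settled f α α

bottom : Ranking f τ → ∃[ α ] Bottom f τ α
bottom {f} R = go R (<-wellFounded _)
  where
  go : Ranking f τ → Acc _<_ (inversions τ) → ∃[ α ] Bottom f τ α
  go {τ} R (acc rs) with settle [] τ R
  ... | inj₁ s = τ , record { ranking = R ; below = ε ; perm = ↭-refl ; settled = s }
  ... | inj₂ (ρ , ex , R′) with go R′ (rs (inversions< ex))
  ...   | α , B = α , record
          { ranking = Bottom.ranking B
          ; below   = Bottom.below B ◅◅ (ex ◅ ε)
          ; perm    = ↭-trans (Bottom.perm B) (exchange⇒↭ ex)
          ; settled = Bottom.settled B
          }

-- The set partition PSA

-- insertLetter keeps the blocks sorted by increasing maxima, so the level of a block is
-- the number of blocks behind it in the list.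
data Levels (f : ℕ → ℕ) : SetPartition → Set where
  []  : Levels f []
  _∷_ : ∀ {B S} → All (λ x → f x ≡ length S) B → Levels f S → Levels f (B ∷ S)

infix 4 _∈∈_
_∈∈_ : ℕ → SetPartition → Set
x ∈∈ S = Any (x ∈ₗ_) S

Sorted : SetPartition → Set
Sorted = AllPairs (λ B C → blockMax B < blockMax C)

-- `maxed` also excludes empty blocks, whose default maximum 0 is not a member.
record Represents (f : ℕ → ℕ) (S : SetPartition) (σ : Word) : Set where
  field
    sorted : Sorted S
    maxed  : All (λ B → blockMax B ∈ₗ B) S
    levels : Levels f S
    covers : x ∈ₗ σ → x ∈∈ S
    within : x ∈∈ S → x ∈ₗ σ

open Represents

private
  variable
    B C : Block
    S L M : SetPartition

∈⇒≤blockMax : x ∈ₗ B → x ≤ blockMax B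
∈⇒≤blockMax {B = B} x∈ = All.lookup (xs≤max 0 B) x∈

blockMax-∷ : All (_≤ x) B → blockMax (x ∷ B) ≡ x
blockMax-∷ {x} {B} B≤x =
  ≤-antisym (max≤v⁺ {xs = x ∷ B} z≤n (≤-refl ∷ B≤x)) (v≤max⁺ {x} 0 (x ∷ B) (inj₂ (here ≤-refl)))

-- In a list with increasing maxima, the block `B` of `onto` is the one that patience sorting
-- selects.
data Position (x : ℕ) : SetPartition → Set where
  front : All (λ B → x < blockMax B) S → Position x S
  onto  : ∀ L {B M} → blockMax B < x → All (λ C → x < blockMax C) M → Position x (L ++ B ∷ M)

position : Sorted S → All (λ B → blockMax B ≢ x) S → Position x S
position [] [] = front []
position {B ∷ S} {x} (B< ∷ srt) (B≢x ∷ ≢x) with <-cmp (blockMax B) x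
... | tri≈ _ B≡x _ = contradiction B≡x B≢x
... | tri> _ _ x<B = front (x<B ∷ All.map (<-trans x<B) B<)
... | tri< B<x _ _ with position srt ≢x
...   | front x<S        = onto [] B<x x<S
...   | onto L C<x x<M = onto (B ∷ L) C<x x<M

insertLetter-front : All (λ B → x < blockMax B) S → insertLetter S x ≡ [ x ] ∷ S
insertLetter-front {x} x<S
  rewrite filter-none (λ B → blockMax B <? x) (All.map <-asym x<S) = refl

sorted⇒prefix< : ∀ L → Sorted (L ++ B ∷ M) → All (λ C → blockMax C < blockMax B) L
sorted⇒prefix< []      _          = []
sorted⇒prefix< (C ∷ L) (C< ∷ srt) = All.head (All.++⁻ʳ L C<) ∷ sorted⇒prefix< L srt

-- Blocks are compared as lists; strictly increasing maxima exclude a second copy of `best`.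
addTo : Block → ℕ → SetPartition → SetPartition
addTo best x = map (λ C → if does (≡-dec _≟_ C best) then x ∷ C else C)

insertLetter-best : ∀ S {T} → filter (λ B → blockMax B <? x) S ≡ C ∷ T →
                    insertLetter S x ≡ addTo (argmax blockMax C T) x S
insertLetter-best S eq rewrite eq = refl

addTo-others : All (λ C → C ≢ B) S → addTo B x S ≡ S
addTo-others []                      = refl
addTo-others {B} {C ∷ S} (C≢B ∷ ≢B) with ≡-dec _≟_ C B
... | yes C≡B = contradiction C≡B C≢B
... | no _    = cong (C ∷_) (addTo-others ≢B)

addTo-self : ∀ B → addTo B x [ B ] ≡ [ x ∷ B ]
addTo-self B with ≡-dec _≟_ B B
... | yes _  = refl
... | no B≢B = contradiction refl B≢B

argmax-last : ∀ T → All (λ D → blockMax D < blockMax B) (C ∷ T) → argmax blockMax C (T ++ [ B ]) ≡ B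
argmax-last {B} {C} T (C<B ∷ T<B) with argmax-sel blockMax C (T ++ [ B ])
  | v≤f[argmax]⁺ {f = blockMax} {v = blockMax B} C (T ++ [ B ]) (inj₂ (Any.++⁺ʳ T (here ≤-refl)))
... | inj₁ eq | B≤ = contradiction C<B (≤⇒≯ (subst (λ D → blockMax B ≤ blockMax D) eq B≤))
... | inj₂ m  | B≤ with ∈-++⁻ T m
...   | inj₁ m∈T       = contradiction (All.lookup T<B m∈T) (≤⇒≯ B≤)
...   | inj₂ (here eq) = eq

insertLetter-onto : ∀ L → Sorted (L ++ B ∷ M) → blockMax B < x → All (λ C → x < blockMax C) M →
                    insertLetter (L ++ B ∷ M) x ≡ L ++ (x ∷ B) ∷ M
insertLetter-onto {B} {M} {x} L srt B<x x<M = chosen L (sorted⇒prefix< L srt) (begin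
    filter below? (L ++ B ∷ M)                ≡⟨ filter-++ below? L (B ∷ M) ⟩
    filter below? L ++ filter below? (B ∷ M)
      ≡⟨ cong₂ _++_ (filter-all below? (All.map (λ C<B → <-trans C<B B<x) (sorted⇒prefix< L srt)))
                    (filter-accept below? B<x) ⟩
    L ++ B ∷ filter below? M                  ≡⟨ cong (λ T → L ++ B ∷ T) (filter-none below? (All.map <-asym x<M)) ⟩
    L ++ [ B ]                                ∎)
  where
  open ≡-Reasoning
  below? = λ C → blockMax C <? x

  addTo-onto : ∀ L → All (λ C → blockMax C < blockMax B) L → addTo B x (L ++ B ∷ M) ≡ L ++ (x ∷ B) ∷ M
  addTo-onto L L<B = begin
    addTo B x (L ++ B ∷ M)                           ≡⟨ map-++ _ L (B ∷ M) ⟩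
    addTo B x L ++ addTo B x ([ B ] ++ M)            ≡⟨ cong (addTo B x L ++_) (map-++ _ [ B ] M) ⟩
    addTo B x L ++ addTo B x [ B ] ++ addTo B x M
      ≡⟨ cong₂ _++_ (addTo-others (All.map (λ { lt refl → <-irrefl refl lt }) L<B))
                    (cong₂ _++_ (addTo-self B) (addTo-others (All.map (λ { x<C refl → <-asym B<x x<C }) x<M))) ⟩
    L ++ (x ∷ B) ∷ M                                 ∎

  -- `argmax` takes the head of the filtered list as its default; for empty `L` this head is `B`
  -- itself.
  chosen : ∀ L → All (λ C → blockMax C < blockMax B) L → filter below? (L ++ B ∷ M) ≡ L ++ [ B ] →
           insertLetter (L ++ B ∷ M) x ≡ L ++ (x ∷ B) ∷ M
  chosen []      L<B eq = ≡-trans (insertLetter-best (B ∷ M) eq) (addTo-onto [] L<B)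
  chosen (C ∷ L) L<B eq = ≡-trans (insertLetter-best (C ∷ L ++ B ∷ M) eq)
    (≡-trans (cong (λ best → addTo best x (C ∷ L ++ B ∷ M)) (argmax-last L L<B)) (addTo-onto (C ∷ L) L<B))

∈∈-onto : ∀ L → y ∈∈ L ++ B ∷ M → y ∈∈ L ++ (x ∷ B) ∷ M
∈∈-onto []      (here y∈)  = here (there y∈)
∈∈-onto []      (there y∈) = there y∈
∈∈-onto (_ ∷ L) (here y∈)  = here y∈
∈∈-onto (_ ∷ L) (there y∈) = there (∈∈-onto L y∈)

∈∈-onto⁻ : ∀ L → y ∈∈ L ++ (x ∷ B) ∷ M → y ≡ x ⊎ y ∈∈ L ++ B ∷ M
∈∈-onto⁻ []      (here (here eq))  = inj₁ eq
∈∈-onto⁻ []      (here (there y∈)) = inj₂ (here y∈)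
∈∈-onto⁻ []      (there y∈)        = inj₂ (there y∈)
∈∈-onto⁻ (_ ∷ L) (here y∈)         = inj₂ (here y∈)
∈∈-onto⁻ (_ ∷ L) (there y∈)        = [ inj₁ , inj₂ ∘ there ]′ (∈∈-onto⁻ L y∈)

sorted-onto : ∀ L → Sorted (L ++ B ∷ M) → blockMax (x ∷ B) ≡ x → blockMax B < x →
              All (λ C → x < blockMax C) M → Sorted (L ++ (x ∷ B) ∷ M)
sorted-onto []      (_ ∷ srt)  eq B<x x<M = All.map (subst (_< _) (sym eq)) x<M ∷ srt
sorted-onto {x = x} (C ∷ L) (C< ∷ srt) eq B<x x<M =
  All.++⁺ (All.++⁻ˡ L C<) (subst (blockMax C <_) (sym eq) (<-trans (All.head C<BM) B<x) ∷ All.tail C<BM)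
    ∷ sorted-onto L srt eq B<x x<M
  where C<BM = All.++⁻ʳ L C<

levels-onto : ∀ L → Levels f (L ++ B ∷ M) → f x ≡ length M → Levels f (L ++ (x ∷ B) ∷ M)
levels-onto []      (eqs ∷ lv) eq = (eq ∷ eqs) ∷ lv
levels-onto {f = f} {B} {M} {x} (C ∷ L) (eqs ∷ lv) eq =
  All.map (λ e → ≡-trans e (≡-trans (length-++ L) (sym (length-++ L)))) eqs ∷ levels-onto L lv eq

levels-cong : ∀ {g : ℕ → ℕ} → (∀ {y} → y ∈∈ S → g y ≡ f y) → Levels f S → Levels g S
levels-cong g≗f []         = []
levels-cong g≗f (eqs ∷ lv) =
  All.tabulate (λ y∈ → ≡-trans (g≗f (here y∈)) (All.lookup eqs y∈)) ∷ levels-cong (g≗f ∘ there) lv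

levels-drop : ∀ L → Levels f (L ++ M) → Levels f M
levels-drop []      lv       = lv
levels-drop (_ ∷ L) (_ ∷ lv) = levels-drop L lv

level<length : Levels f S → y ∈∈ S → f y < length S
level<length (eqs ∷ _) (here y∈)  = ≤-reflexive (cong suc (All.lookup eqs y∈))
level<length (_ ∷ lv)  (there y∈) = m≤n⇒m≤1+n (level<length lv y∈)

-- Appending a letter to a ranked word

update : (ℕ → ℕ) → ℕ → ℕ → ℕ → ℕ
update f x k y with y ≟ x
... | yes _ = k
... | no _  = f y

update-≡ : ∀ f x k → update f x k x ≡ k
update-≡ f x k with x ≟ x
... | yes _  = refl
... | no x≢x = contradiction refl x≢x

update-≢ : ∀ f k → y ≢ x → update f x k y ≡ f y
update-≢ {y} {x} f k y≢x with y ≟ x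
... | yes y≡x = contradiction y≡x y≢x
... | no _    = refl

update-∈ : ∀ {k} → x ∉ₗ σ → y ∈ₗ σ → update f x k y ≡ f y
update-∈ {f = f} {k} x∉ y∈ = update-≢ f k λ { refl → x∉ y∈ }

-- A last letter influences no other level, so only the conditions on `x` itself are new.
ranking-∷ʳ : ∀ {k} → Ranking f σ → x ∉ₗ σ → (∀ {y} → y ∈ₗ σ → x < y → f y < k) →
             k ≡ 0 ⊎ ∃[ y ] (y ∈ₗ σ × x < y × suc (f y) ≡ k) → Ranking (update f x k) (σ ∷ʳ x)
ranking-∷ʳ R x∉ low att .unique = Unique.++⁺ (unique R) ([] ∷ []) λ { (x∈ , here refl) → x∉ x∈ }
ranking-∷ʳ {f} {σ} {x} {k} R x∉ low att .lower r lt with before-∷ʳ⁻ σ r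
... | inj₁ s = subst₂ _<_ (sym (update-∈ x∉ (before⇒∈ˡ s))) (sym (update-∈ x∉ (before⇒∈ʳ s))) (lower R s lt)
... | inj₂ (y∈ , refl) = subst₂ _<_ (sym (update-∈ x∉ y∈)) (sym (update-≡ f x k)) (low y∈ lt)
ranking-∷ʳ {f} {σ} {x} {k} R x∉ low att .attain m with ∈-++⁻ σ m
... | inj₁ z∈ = [ inj₁ ∘ ≡-trans (update-∈ x∉ z∈)
                , (λ { (y , r , lt , eq) → inj₂ (y , before-++⁺ˡ r , lt ,
                      ≡-trans (cong suc (update-∈ x∉ (before⇒∈ˡ r))) (≡-trans eq (sym (update-∈ x∉ z∈)))) }) ]′
                (attain R z∈)
... | inj₂ (here refl) = [ inj₁ ∘ ≡-trans (update-≡ f x k)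
                , (λ { (y , y∈ , lt , eq) → inj₂ (y , before-++ y∈ (here refl) , lt ,
                      ≡-trans (cong suc (update-∈ x∉ y∈)) (≡-trans eq (sym (update-≡ f x k)))) }) ]′
                att

-- The witness is the maximum of the first block of `M`, whose level is one less than the length of
-- `M`.
last-level-attained : All (λ B → blockMax B ∈ₗ B) M → Levels f M → All (λ C → x < blockMax C) M →
                      length M ≡ 0 ⊎ ∃[ y ] (y ∈∈ M × x < y × suc (f y) ≡ length M)
last-level-attained []       []        []       = inj₁ refl
last-level-attained (m ∷ _) (eqs ∷ _) (lt ∷ _) = inj₂ (_ , here m , lt , cong suc (All.lookup eqs m))

insert-represents : Ranking f σ → Represents f S σ → x ∉ₗ σ →
                    ∃[ g ] (Ranking g (σ ∷ʳ x) × Represents g (insertLetter S x) (σ ∷ʳ x))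
-- Block maxima are letters of `σ`, so none equals the new letter.
insert-represents {f} {σ} {S} {x} R rep x∉ with position (sorted rep) (All.tabulate λ B∈ eq →
    x∉ (subst (_∈ₗ σ) eq (within rep (lose B∈ (All.lookup (maxed rep) B∈)))))
... | front x<S rewrite insertLetter-front x<S = update f x (length S)
  , ranking-∷ʳ R x∉ (λ y∈ _ → level<length (levels rep) (covers rep y∈))
      (Sum.map₂ (λ { (y , y∈ , rest) → y , within rep y∈ , rest }) (last-level-attained (maxed rep) (levels rep) x<S))
  , record
    { sorted = All.map (subst (_< _) (sym (blockMax-∷ []))) x<S ∷ sorted rep
    ; maxed  = subst (_∈ₗ [ x ]) (sym (blockMax-∷ [])) (here refl) ∷ maxed rep
    ; levels = (update-≡ f x _ ∷ []) ∷ levels-cong (update-∈ x∉ ∘ within rep) (levels rep)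
    ; covers = [ there ∘ covers rep , here ]′ ∘ ∈-++⁻ σ
    ; within = λ { (here x∈) → ∈-++⁺ʳ σ x∈ ; (there y∈) → ∈-++⁺ˡ (within rep y∈) }
    }
... | onto L {B} {M} B<x x<M rewrite insertLetter-onto L (sorted rep) B<x x<M = update f x (length M)
  , ranking-∷ʳ R x∉ (λ y∈ x<y → level<length lvM (later L (sorted rep) (covers rep y∈) x<y))
      (Sum.map₂ (λ { (y , y∈ , rest) → y , within rep (Any.++⁺ʳ L (there y∈)) , rest })
        (last-level-attained (All.tail (All.++⁻ʳ L (maxed rep))) lvM x<M))
  , record
    { sorted = sorted-onto L (sorted rep) max≡x B<x x<M
    ; maxed  = All.++⁺ (All.++⁻ˡ L (maxed rep))
                 (subst (_∈ₗ x ∷ B) (sym max≡x) (here refl) ∷ All.tail (All.++⁻ʳ L (maxed rep)))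
    ; levels = levels-onto L (levels-cong (update-∈ x∉ ∘ within rep) (levels rep)) (update-≡ f x _)
    ; covers = [ ∈∈-onto L ∘ covers rep , (λ { (here refl) → Any.++⁺ʳ L (here (here refl)) }) ]′ ∘ ∈-++⁻ σ
    ; within = [ (λ { refl → ∈-insert σ }) , ∈-++⁺ˡ ∘ within rep ]′ ∘ ∈∈-onto⁻ L
    }
  where
  max≡x : blockMax (x ∷ B) ≡ x
  max≡x = blockMax-∷ (All.map (λ y≤B → <⇒≤ (≤-<-trans y≤B B<x)) (xs≤max 0 B))
  lvM : Levels f M
  lvM = levels-drop [ B ] (levels-drop L (levels rep))
  -- A letter above `x` exceeds the maximum of `B` and of every block before it.
  later : ∀ L → Sorted (L ++ B ∷ M) → y ∈∈ L ++ B ∷ M → x < y → y ∈∈ M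
  later []      _          (here y∈)  x<y = contradiction (<-≤-trans x<y (∈⇒≤blockMax y∈)) (<-asym B<x)
  later []      _          (there y∈) x<y = y∈
  later (C ∷ L) (C< ∷ _)   (here y∈)  x<y =
    contradiction (<-≤-trans x<y (∈⇒≤blockMax y∈)) (<-asym (<-trans (All.head (All.++⁻ʳ L C<)) B<x))
  later (C ∷ L) (_ ∷ srt) (there y∈) x<y = later L srt y∈ x<y

PSA-represents : Unique σ → ∃[ f ] (Ranking f σ × Represents f (PSA σ) σ)
-- Any function ranks the empty word; the constant 0 is an arbitrary start.
PSA-represents {σ} U = go [] σ {f = λ _ → 0} empty-ranking empty-represents U
  where
  empty-ranking : ∀ {f} → Ranking f []
  empty-ranking = record { unique = [] ; lower = λ () ; attain = λ () }
  empty-represents : ∀ {f} → Represents f [] []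
  empty-represents = record { sorted = [] ; maxed = [] ; levels = [] ; covers = λ () ; within = λ () }
  go : ∀ p q {f S} → Ranking f p → Represents f S p → Unique (p ++ q) →
       ∃[ g ] (Ranking g (p ++ q) × Represents g (foldl insertLetter S q) (p ++ q))
  go p [] R rep U rewrite ++-identityʳ p = _ , R , rep
  go p (x ∷ q) R rep U
    with insert-represents R rep (λ x∈ → before-irrefl U (before-++ x∈ (here refl)))
  ... | _ , R′ , rep′ rewrite sym (++-assoc p [ x ] q) = go (p ∷ʳ x) q R′ rep′ U

-- The order P

same-block⇒level≡ : Levels f S → B ∈ₗ S → x ∈ₗ B → y ∈ₗ B → f x ≡ f y
same-block⇒level≡ (eqs ∷ _) (here refl) x∈ y∈ = ≡-trans (All.lookup eqs x∈) (sym (All.lookup eqs y∈))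
same-block⇒level≡ (_ ∷ lv)  (there B∈)  x∈ y∈ = same-block⇒level≡ lv B∈ x∈ y∈

-- Levels strictly decrease along the list of blocks.
level≡⇒same-block : Levels f S → B ∈ₗ S → y ∈ₗ B → z ∈∈ S → f z ≡ f y → z ∈ₗ B
level≡⇒same-block (eqs ∷ lv) (here refl) y∈ (here z∈)  eq = z∈
level≡⇒same-block (eqs ∷ lv) (here refl) y∈ (there z∈) eq =
  contradiction (≡-trans eq (All.lookup eqs y∈)) (<⇒≢ (level<length lv z∈))
level≡⇒same-block (eqs ∷ lv) (there B∈)  y∈ (here z∈)  eq =
  contradiction (≡-trans (sym eq) (All.lookup eqs z∈)) (<⇒≢ (level<length lv (lose B∈ y∈)))
level≡⇒same-block (_ ∷ lv)   (there B∈)  y∈ (there z∈) eq = level≡⇒same-block lv B∈ y∈ z∈ eq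

-- Going left means going further along the list; an entry beyond the next would leave a block with
-- its maximum strictly between.
immediatelyLeft⇒level : Levels f S → Sorted S → ImmediatelyLeft S C B → x ∈ₗ B → y ∈ₗ C → suc (f y) ≡ f x
immediatelyLeft⇒level _ _ (here refl , here refl , lt , _) x∈ y∈ = contradiction lt (<-irrefl refl)
immediatelyLeft⇒level _ (B< ∷ _) (here refl , there B∈ , lt , _) x∈ y∈ =
  contradiction lt (<-asym (All.lookup B< B∈))
immediatelyLeft⇒level (eqs ∷ eqs′ ∷ _) _ (there (here refl) , here refl , _) x∈ y∈ =
  ≡-trans (cong suc (All.lookup eqs′ y∈)) (sym (All.lookup eqs x∈))
immediatelyLeft⇒level _ ((B<D ∷ _) ∷ D< ∷ _) (there (there C∈) , here refl , _ , none) x∈ y∈ =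
  contradiction (B<D , All.lookup D< C∈) (none (there (here refl)))
immediatelyLeft⇒level (_ ∷ lv) (_ ∷ srt) (there C∈ , there B∈ , lt , none) x∈ y∈ =
  immediatelyLeft⇒level lv srt (C∈ , B∈ , lt , none ∘ there) x∈ y∈

level⇒immediatelyLeft : Levels f S → Sorted S → C ∈ₗ S → B ∈ₗ S → x ∈ₗ B → y ∈ₗ C → suc (f y) ≡ f x →
                        ImmediatelyLeft S C B
level⇒immediatelyLeft (eqs ∷ lv) _ (here refl) B∈ x∈ y∈ eq = contradiction
  (≤-trans (level<length (eqs ∷ lv) (lose B∈ x∈)) (s≤s (≤-reflexive (sym (All.lookup eqs y∈)))))
  (<⇒≱ (s≤s (≤-reflexive eq)))
level⇒immediatelyLeft (eqs ∷ _ ∷ _) ((B<C ∷ _) ∷ C< ∷ _) (there (here refl)) (here refl) x∈ y∈ eq =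
  there (here refl) , here refl , B<C , λ where
    (here refl)         (B<B , _) → <-irrefl refl B<B
    (there (here refl)) (_ , C<C) → <-irrefl refl C<C
    (there (there D∈))  (_ , D<C) → <-asym D<C (All.lookup C< D∈)
level⇒immediatelyLeft (eqs ∷ _ ∷ lv) _ (there (there C∈)) (here refl) x∈ y∈ eq =
  contradiction (suc-injective (≡-trans eq (All.lookup eqs x∈))) (<⇒≢ (level<length lv (lose C∈ y∈)))
level⇒immediatelyLeft (_ ∷ lv) (D< ∷ srt) (there C∈) (there B∈) x∈ y∈ eq
  with level⇒immediatelyLeft lv srt C∈ B∈ x∈ y∈ eq
... | _ , _ , B<C , none = there C∈ , there B∈ , B<C , λ where
    (here refl) (B<D , _) → <-asym B<D (All.lookup D< B∈)
    (there D∈)            → none D∈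

greatest-below : y ∈ₗ B → y < x → ∃[ m ] (GreatestBelow x B m × y ≤ m)
greatest-below {y} {B} {x} y∈ y<x =
    m
  , (proj₁ m-good , proj₂ m-good , λ z∈ z<x → All.lookup (xs≤max y candidates) (∈-filter⁺ (_<? x) z∈ z<x))
  , ⊥≤max y candidates
  where
  candidates = filter (_<? x) B
  m = max y candidates
  m-good = ∈-filter⁻ (_<? x) {xs = B}
    ([ (λ eq → subst (_∈ₗ candidates) (sym eq) (∈-filter⁺ (_<? x) y∈ y<x)) , id ]′ (argmax-sel id y candidates))

module _ (rep : Represents f S σ) where

  PStep⇒step : PStep S y x → Step f σ y x
  PStep⇒step (sameBlock s∈ x∈ (y∈ , y<x , _)) =
    sameLevel (within rep (lose s∈ y∈)) (within rep (lose s∈ x∈)) (same-block⇒level≡ (levels rep) s∈ y∈ x∈) y<x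
  PStep⇒step (leftBlock I@(t∈ , s∈ , _) x∈ (y∈ , x<y , least)) =
    nextLevel (within rep (lose t∈ y∈)) (within rep (lose s∈ x∈))
      (immediatelyLeft⇒level (levels rep) (sorted rep) I x∈ y∈) x<y
      λ z∈ eq x<z → least (level≡⇒same-block (levels rep) t∈ y∈ (covers rep z∈) eq) x<z

  -- `sameBlock` only reaches the predecessor within a block, so a chain of predecessors leads from
  -- `x` down to `y`.
  same-block⇒P : ∀ {s} → s ∈ₗ S → Acc _<_ x → x ∈ₗ s → y ∈ₗ s → y < x → P S y x
  same-block⇒P s∈ (acc rs) x∈ y∈ y<x with greatest-below y∈ y<x
  ... | m , g@(m∈ , m<x , _) , y≤m with m≤n⇒m<n∨m≡n y≤m
  ...   | inj₂ refl = sameBlock s∈ x∈ g ◅ ε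
  ...   | inj₁ y<m  = same-block⇒P s∈ (rs m<x) m∈ y∈ y<m ◅◅ sameBlock s∈ x∈ g ◅ ε

  step⇒P : Step f σ y x → P S y x
  step⇒P {y} {x} (sameLevel y∈ x∈ eq y<x) with find (covers rep x∈)
  ... | s , s∈ , x∈s =
    same-block⇒P s∈ (<-wellFounded x) x∈s (level≡⇒same-block (levels rep) s∈ x∈s (covers rep y∈) eq) y<x
  step⇒P (nextLevel y∈ x∈ eq x<y least) with find (covers rep y∈) | find (covers rep x∈)
  ... | t , t∈ , y∈t | s , s∈ , x∈s =
    leftBlock (level⇒immediatelyLeft (levels rep) (sorted rep) t∈ s∈ x∈s y∈t eq) x∈s
      (y∈t , x<y , λ z∈ → least (within rep (lose t∈ z∈)) (same-block⇒level≡ (levels rep) t∈ z∈ y∈t)) ◅ ε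

-- Rankings as invariants of Bell classes, and the three assertions

step⇒≢ : Step f w y x → y ≢ x
step⇒≢ (sameLevel _ _ _ y<x)   = <⇒≢ y<x
step⇒≢ (nextLevel _ _ _ x<y _) = <⇒≢ x<y ∘ sym

𝔖⇒Unique : ∀ {n} → σ ∈ 𝔖 n → Unique σ
𝔖⇒Unique {n = n} σ∈ = Unique-resp-↭ (↭-sym σ∈) (Unique.map⁺ suc-injective (Unique.upTo⁺ n))

≡ᴮ⇒ranking : σ ≡ᴮ τ → Ranking f σ → Ranking f τ
≡ᴮ⇒ranking {σ} {τ} {f} eq R = subst (Ranking f) (++-identityʳ τ)
  (proj₁ (≡ᴮ-ranking eq [] []) (subst (Ranking f) (sym (++-identityʳ σ)) R))

-- Both words rise by Bell steps to avoiders of the same ranking, which coincide.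
ranking⇒≡ᴮ : Ranking f σ → Ranking f τ → σ ↭ τ → σ ≡ᴮ τ
ranking⇒≡ᴮ R S σ↭τ with top R | top S
... | ω , T | ω′ , T′
  with avoider-unique (Top.ranking T) (Top.ranking T′)
         (↭-trans (↭-sym (Top.perm T)) (↭-trans σ↭τ (Top.perm T′))) (Top.avoids T) (Top.avoids T′)
...   | refl = ≡ᴮ-trans (Top.bellEq T) (≡ᴮ-sym (Top.bellEq T′))

theorem5p1 : (n : ℕ) →
    (∀ {σ} → σ ∈ 𝔖 n → IsInterval n (BellClass n σ)) ×
    (∀ {σ} → σ ∈ 𝔖 n → BellClass n σ ≐ LinearExtensions n (P (PSA σ))) ×
    ((λ τ → ∃[ σ ] (σ ∈ 𝔖 n × τ ∈ MaximalIn (BellClass n σ)))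
    ≐ (λ τ → τ ∈ 𝔖 n × τ ∈ Avoids21-3))
theorem5p1 n = interval , linear-extensions , maximal⇒avoids , avoids⇒maximal
  where
  perm : σ ∈ 𝔖 n → τ ∈ 𝔖 n → σ ↭ τ
  perm σ∈ τ∈ = ↭-trans σ∈ (↭-sym τ∈)

  interval : σ ∈ 𝔖 n → IsInterval n (BellClass n σ)
  interval {σ} σ∈ with PSA-represents (𝔖⇒Unique σ∈)
  ... | f , R , _ with bottom R | top R
  ...   | α , Bσ | ω , Tσ = α , ω , ↭-trans (Bottom.perm Bσ) σ∈ , ↭-trans (↭-sym (Top.perm Tσ)) σ∈ , to , from
    where
    to : BellClass n σ τ → Interval n α ω τ
    to (τ∈ , σ≡τ) with ≡ᴮ⇒ranking σ≡τ R
    ... | R′ with bottom R′ | top R′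
    ...   | α′ , Bτ | ω′ , Tτ
      -- The endpoints reached from `τ` agree with those reached from `σ`, because both words have
      -- the ranking `f`.
      with settled-unique (Bottom.ranking Bσ) (Bottom.ranking Bτ)
             (↭-trans (Bottom.perm Bσ) (↭-trans (perm σ∈ τ∈) (↭-sym (Bottom.perm Bτ))))
             (Bottom.settled Bσ) (Bottom.settled Bτ)
         | avoider-unique (Top.ranking Tσ) (Top.ranking Tτ)
             (↭-trans (↭-sym (Top.perm Tσ)) (↭-trans (perm σ∈ τ∈) (Top.perm Tτ)))
             (Top.avoids Tσ) (Top.avoids Tτ)
    ...     | refl | refl = τ∈ , Bottom.below Bτ , Top.above Tτ

    from : Interval n α ω τ → BellClass n σ τ
    from {τ} (τ∈ , α≤τ , τ≤ω) = τ∈ , ranking⇒≡ᴮ R (respects⇒ranking R (perm σ∈ τ∈) respects) (perm σ∈ τ∈)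
      where
      respects : Respects (Step f σ) τ
      respects {y} {x} s with <-cmp y x
      ... | tri< y<x _ _ = ≤ᴿ-noninversion τ≤ω y<x (ranking⇒respects (Top.ranking Tσ) (step-resp-↭ (Top.perm Tσ) s))
      ... | tri≈ _ y≡x _ = contradiction y≡x (step⇒≢ s)
      ... | tri> _ _ x<y =
        ≤ᴿ-inversion α≤τ x<y (ranking⇒respects (Bottom.ranking Bσ) (step-resp-↭ (↭-sym (Bottom.perm Bσ)) s))

  linear-extensions : σ ∈ 𝔖 n → BellClass n σ ≐ LinearExtensions n (P (PSA σ))
  linear-extensions {σ} σ∈ with PSA-represents (𝔖⇒Unique σ∈)
  ... | f , R , rep = to , from
    where
    to : BellClass n σ τ → LinearExtensions n (P (PSA σ)) τ
    to (τ∈ , σ≡τ) = τ∈ , λ x≤y x≢y →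
      [ (λ x≡y → contradiction x≡y x≢y) , before⇒precedes ]′
        (order⇒≡⊎before (unique R′) (ranking⇒respects R′ ∘ step-resp-↭ (perm σ∈ τ∈))
          (Star.map (PStep⇒step rep) x≤y))
      where R′ = ≡ᴮ⇒ranking σ≡τ R
    from : LinearExtensions n (P (PSA σ)) τ → BellClass n σ τ
    from {τ} (τ∈ , ext) = τ∈ , ranking⇒≡ᴮ R (respects⇒ranking R (perm σ∈ τ∈) respects) (perm σ∈ τ∈)
      where
      respects : Respects (Step f σ) τ
      respects s = precedes⇒before τ (ext (step⇒P rep s) (step⇒≢ s))

  maximal⇒avoids : ∃[ σ ] (σ ∈ 𝔖 n × τ ∈ MaximalIn (BellClass n σ)) → τ ∈ 𝔖 n × τ ∈ Avoids21-3
  maximal⇒avoids {τ} (σ , σ∈ , (τ∈ , σ≡τ) , maximal) = τ∈ , ¬has21-3⇒avoids τ ¬h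
    where
    ¬h : ¬ Has21-3 τ
    ¬h h with has21-3⇒bellUp (𝔖⇒Unique τ∈) h
    -- The Bell step leads to a strictly greater member of the class.
    ... | ρ , up = <⇒≢ (inversions< ex) (cong inversions (maximal
            (↭-trans (↭-sym (exchange⇒↭ ex)) τ∈ , ≡ᴮ-trans σ≡τ (bellUp⇒≡ᴮ up)) (ex ◅ ε)))
      where ex = bellUp⇒exchange up

  avoids⇒maximal : τ ∈ 𝔖 n × τ ∈ Avoids21-3 → ∃[ σ ] (σ ∈ 𝔖 n × τ ∈ MaximalIn (BellClass n σ))
  avoids⇒maximal {τ} (τ∈ , avoids) = τ , τ∈ , (τ∈ , ≡ᴮ-refl) , maximal
    where
    maximal : ∀ {ρ} → ρ ∈ BellClass n τ → τ ≤ᴿ ρ → τ ≡ ρ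
    maximal (ρ∈ , τ≡ρ) τ≤ρ with PSA-represents (𝔖⇒Unique τ∈)
    ... | f , R , _ with top (≡ᴮ⇒ranking τ≡ρ R)
    -- The avoider above `ρ` has the ranking of `τ`, so it is `τ` itself and `ρ` lies below `τ`.
    ...   | ω , T with avoider-unique R (Top.ranking T) (↭-trans (perm τ∈ ρ∈) (Top.perm T))
                         (avoids⇒¬has21-3 τ avoids) (Top.avoids T)
    ...     | refl = ≤ᴿ-antisym τ≤ρ (Top.above T)
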